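{- Every graph $G=(V,E)$ has a unique pruned subgraph up to isomorphism.
   Context: All graphs are finite and simple. A vertex $v$ of a graph $G=(V,E)$ is a one-vertex extension if one of the following holds: $N_G[v]=V$ (universal); $N_G(v)=\emptyset$ (isolated); $N_G[v]=V\setminus\{u\}$ for some $u\in V\setminus\{v\}$ (anti-pendant); $N_G(v)=\{u\}$ for some $u\in V\setminus\{v\}$ (pendant); $N_G[v]=N_G[u]$ for some $u\in V\setminus\{v\}$ (true twin); $N_G(v)=N_G(u)$ for some $u\in V\setminus\{v\}$ (false twin). A pruned subgraph of $G$ is any graph obtained from $G$ by sequentially removing one-vertex extensions (one at a time, with respect to the current subgraph) until no more can be removed; the process stops when a single vertex remains. -}

module Defs where

open import Data.Fin.Base using (Fin)
open import Data.Fin.Subset using (Subset; _∈_; ⊤; ⊥; ⁅_⁆; _∩_; _∪_; _-_; ∣_∣)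
open import Data.Nat.Base using (ℕ; _<_)
open import Data.Product.Base using (∃; _×_; proj₁)
open import Data.Vec.Base using (tabulate)
open import Function.Bundles using (_↔_; _⇔_; Inverse)
open import Level using (0ℓ)
open import Relation.Binary.Construct.Closure.ReflexiveTransitive using (Star)
open import Relation.Binary.Core using (Rel)
open import Relation.Binary.Definitions using (Decidable; Irreflexive; Symmetric)
open import Relation.Binary.PropositionalEquality.Core using (_≡_; _≢_)
open import Relation.Nullary.Decidable.Core using (does)
open import Relation.Nullary.Negation.Core using (¬_)

record Graph (n : ℕ) : Set₁ where
  field
    Adj    : Rel (Fin n) 0ℓ
    adj?   : Decidable Adj
    sym    : Symmetric Adj
    irrefl : Irreflexive _≡_ Adj

module _ {n : ℕ} (G : Graph n) where
  open Graph G

  -- Deleting vertices always leaves an induced subgraph, so a subgraph G[S] is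
  -- represented by its vertex set S, and G itself by ⊤.  Neighbourhoods are
  -- taken inside G[S].

  N : Subset n → Fin n → Subset n
  N S v = S ∩ tabulate (λ w → does (adj? v w))

  N[_] : Subset n → Fin n → Subset n
  N[ S ] v = ⁅ v ⁆ ∪ N S v

  data OneVertexExtension (S : Subset n) (v : Fin n) : Set where
    universal   : N[ S ] v ≡ S → OneVertexExtension S v
    isolated    : N S v ≡ ⊥ → OneVertexExtension S v
    antiPendant : ∀ {u} → u ∈ S → u ≢ v → N[ S ] v ≡ S - u → OneVertexExtension S v
    pendant     : ∀ {u} → u ∈ S → u ≢ v → N S v ≡ ⁅ u ⁆ → OneVertexExtension S v
    trueTwin    : ∀ {u} → u ∈ S → u ≢ v → N[ S ] v ≡ N[ S ] u → OneVertexExtension S v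
    falseTwin   : ∀ {u} → u ∈ S → u ≢ v → N S v ≡ N S u → OneVertexExtension S v

  -- The bound 1 < ∣ S ∣ stops the process at a single vertex, which would
  -- otherwise be removable, being both universal and isolated.
  data _⟶_ (S : Subset n) : Subset n → Set where
    remove : ∀ {v} → 1 < ∣ S ∣ → v ∈ S → OneVertexExtension S v → S ⟶ (S - v)

  IsPrunedSubgraph : Subset n → Set
  IsPrunedSubgraph S = Star _⟶_ ⊤ S × (∀ {T} → ¬ (S ⟶ T))

  -- Isomorphism of the induced subgraphs G[S] and G[T].
  _≅_ : Rel (Subset n) 0ℓ
  S ≅ T = ∃ λ (f : ∃ (_∈ S) ↔ ∃ (_∈ T)) →
    ∀ x y → Adj (proj₁ x) (proj₁ y) ⇔ Adj (proj₁ (Inverse.to f x)) (proj₁ (Inverse.to f y))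

{-# OPTIONS --safe #-}

-- When ∣S∣ > 1, a vertex v is a one-vertex extension of G[S] iff there is some
-- u ∈ S \ {v} such that, on S \ {u, v}, the row of v is constant or equals the
-- row of u; whether v is adjacent to u is irrelevant.  If v and w are both
-- removable, deleting v leaves w removable unless v and w are twins, and in that
-- case G[S - v] and G[S - w] are isomorphic.  So removal is locally confluent up
-- to isomorphism, and Newman's argument applies.
module Submission where

open import Data.Bool.Base using (true)
open import Data.Empty renaming (⊥ to Empty) using (⊥-elim)
open import Data.Fin.Base using (Fin)
open import Data.Fin.Properties using (_≟_; any?; all?)
open import Data.Fin.Subset
  using (Subset; _∈_; _⊆_; ⊤; ⊥; ⁅_⁆; _-_; ∣_∣)
open import Data.Fin.Subset.Properties
open import Data.Nat.Base using (ℕ; zero; suc; _≤_; _<_)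
open import Data.Nat.Properties
  using (≤-trans; ≤-refl; ≤-reflexive; <-≤-trans; ≤-<-trans; <⇒≱; ≤-pred; n≮0)
open import Data.Product using (∃!; ∃; ∃₂; _×_; _,_; proj₁; proj₂)
open import Data.Sum.Base using (_⊎_; inj₁; inj₂)
open import Data.Unit.Base renaming (⊤ to Unit) using (tt)
open import Data.Vec.Properties using ([]=⇒lookup; lookup⇒[]=; lookup∘tabulate)
open import Data.Vec.Properties.WithK using ([]=-irrelevant)
open import Function.Base using (_∘_; id)
open import Function.Bundles using (_⇔_; mk⇔; mk↔ₛ′; Equivalence; Injection; Inverse)
open import Function.Properties.Inverse using (↔⇒↣)
open import Function.Construct.Composition using (_⇔-∘_; _↔-∘_)
open import Function.Construct.Identity using (⇔-id; ↔-id)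
open import Function.Construct.Symmetry using (⇔-sym; ↔-sym)
open import Relation.Binary.Construct.Closure.ReflexiveTransitive using (Star; ε; _◅_)
open import Relation.Binary.PropositionalEquality
  using (_≡_; _≢_; refl; sym; trans; cong; subst; subst₂; ≢-sym)
open import Relation.Nullary using (Dec; yes; no; does; ¬_; contradiction)
open import Relation.Nullary.Decidable
  using (map′; dec-true; _×-dec_; _⊎-dec_; _→-dec_; ¬?)
open import Defs

private
  variable
    n : ℕ
    S T U : Subset n
    u v w x : Fin n

-- Finite subsets and deletion of a point.

does-true⁻ : {A : Set} (a? : Dec A) → does a? ≡ true → A
does-true⁻ (yes a) _ = a

-- Deleting `x` twice equals deleting it once, whereas a member `x` of `p - x` would make the second
-- deletion strict.
x∉p-x : ∀ (p : Subset n) x → ¬ x ∈ p - x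
x∉p-x p x x∈ = ⊂-irref (p─q─q≡p─q p ⁅ x ⁆) (x∈p⇒p-x⊂p x∈)

x∈p-y⇒x≢y : x ∈ S - v → x ≢ v
x∈p-y⇒x≢y {S = S} x∈ refl = x∉p-x S _ x∈

x∈p-y⇒x∈p : x ∈ S - v → x ∈ S
x∈p-y⇒x∈p {S = S} = p─q⊆p S _

∃∈-≡ : {a b : ∃ (_∈ S)} → proj₁ a ≡ proj₁ b → a ≡ b
∃∈-≡ {a = x , p} {b = .x , q} refl = cong (x ,_) ([]=-irrelevant p q)

1<∣p∣⇒∃≢ : 1 < ∣ S ∣ → ∀ v → ∃ λ u → u ∈ S × u ≢ v
1<∣p∣⇒∃≢ {S = S} 1<S v with any? (λ u → u ∈? S ×-dec ¬? (u ≟ v))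
... | yes p = p
... | no ∄u = contradiction (≤-trans (p⊆q⇒∣p∣≤∣q∣ S⊆⁅v⁆) (≤-reflexive (∣⁅x⁆∣≡1 v))) (<⇒≱ 1<S)
  where
  S⊆⁅v⁆ : S ⊆ ⁅ v ⁆
  S⊆⁅v⁆ {x} x∈S with x ≟ v
  ... | yes refl = x∈⁅x⁆ v
  ... | no x≢v   = contradiction (x , x∈S , x≢v) ∄u

∃≢⇒1<∣p∣ : v ∈ S → u ∈ S → u ≢ v → 1 < ∣ S ∣
∃≢⇒1<∣p∣ {v = v} {S = S} {u = u} v∈S u∈S u≢v =
  ≤-<-trans (≤-trans (≤-reflexive (sym (∣⁅x⁆∣≡1 u))) (p⊆q⇒∣p∣≤∣q∣ ⁅u⁆⊆)) (x∈p⇒∣p-x∣<∣p∣ v∈S)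
  where
  ⁅u⁆⊆ : ⁅ u ⁆ ⊆ S - v
  ⁅u⁆⊆ x∈ with refl ← x∈⁅y⁆⇒x≡y u x∈ = x∈p∧x≢y⇒x∈p-y u∈S u≢v

-- replace v w sends S - w to S - v when v ∈ S, with inverse replace w v.
replace : Fin n → Fin n → Fin n → Fin n
replace v w x with x ≟ v
... | yes _ = w
... | no  _ = x

-- `replace v w` is no swap: it sends both `v` and `w` to `w`, so `w` has to be excluded.
replace-inverse : ∀ (v w x : Fin n) → x ≢ w → replace w v (replace v w x) ≡ x
replace-inverse v w x x≢w with x ≟ v
... | no _ with x ≟ w
...   | yes x≡w = contradiction x≡w x≢w
...   | no _    = refl
replace-inverse v w x x≢w | yes x≡v with w ≟ w
...   | yes _   = sym x≡v
...   | no  w≢w = contradiction refl w≢w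

replace-∈ : v ≢ w → w ∈ S → x ∈ S - w → replace v w x ∈ S - v
replace-∈ {v = v} {x = x} v≢w w∈S x∈ with x ≟ v
... | yes _   = x∈p∧x≢y⇒x∈p-y w∈S (≢-sym v≢w)
... | no  x≢v = x∈p∧x≢y⇒x∈p-y (x∈p-y⇒x∈p x∈) x≢v

module _ (G : Graph n) where
  open Graph G renaming (sym to Adj-sym)
  open Equivalence using (to; from)

  private
    _≃_ : Subset n → Subset n → Set
    _≃_ = _≅_ G

    _⇝_ : Subset n → Subset n → Set
    _⇝_ = _⟶_ G

  ¬Adj-refl : ¬ Adj v v
  ¬Adj-refl = irrefl refl

  Adj-comm : Adj v w ⇔ Adj w v
  Adj-comm = mk⇔ Adj-sym Adj-sym

  -- Isomorphisms of induced subgraphs.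

  mk≅ : (f : ∃ (_∈ S) → ∃ (_∈ T)) (g : ∃ (_∈ T) → ∃ (_∈ S)) →
        (∀ y → proj₁ (f (g y)) ≡ proj₁ y) → (∀ x → proj₁ (g (f x)) ≡ proj₁ x) →
        (∀ x y → Adj (proj₁ x) (proj₁ y) ⇔ Adj (proj₁ (f x)) (proj₁ (f y))) → S ≃ T
  mk≅ f g fg gf adj = mk↔ₛ′ f g (∃∈-≡ ∘ fg) (∃∈-≡ ∘ gf) , adj

  ≅-refl : S ≃ S
  ≅-refl = ↔-id _ , λ _ _ → ⇔-id _

  ≅-sym : S ≃ T → T ≃ S
  ≅-sym (f , adj) = ↔-sym f , λ x y →
    subst₂ (λ a b → Adj (proj₁ a) (proj₁ b) ⇔ Adj (proj₁ (f.from x)) (proj₁ (f.from y)))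
      (f.strictlyInverseˡ x) (f.strictlyInverseˡ y) (⇔-sym (adj _ _))
    where module f = Inverse f

  ≅-trans : S ≃ T → T ≃ U → S ≃ U
  ≅-trans (f , f-adj) (g , g-adj) = g ↔-∘ f , λ x y → g-adj _ _ ⇔-∘ f-adj x y

  image : S ≃ T → v ∈ S → ∃ (_∈ T)
  image (f , _) v∈S = Inverse.to f (_ , v∈S)

  to-injective : ((f , _) : S ≃ T) {a b : ∃ (_∈ S)} →
                 proj₁ (Inverse.to f a) ≡ proj₁ (Inverse.to f b) → proj₁ a ≡ proj₁ b
  to-injective (f , _) eq = cong proj₁ (Injection.injective (↔⇒↣ f) (∃∈-≡ eq))

  ≅-remove : (i : S ≃ T) (v∈S : v ∈ S) → (S - v) ≃ (T - proj₁ (image i v∈S))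
  ≅-remove {S} {T} {v} (f , adj) v∈S = mk≅ to′ from′
    -- Passing through the smaller set rebuilds the membership proof, so `∃∈-≡ refl` identifies the
    -- proofs before the inverse law of `f` applies.
    (λ y → trans (cong (proj₁ ∘ f.to) (∃∈-≡ refl)) (cong proj₁ (f.strictlyInverseˡ (forget y))))
    (λ x → trans (cong (proj₁ ∘ f.from) (∃∈-≡ refl)) (cong proj₁ (f.strictlyInverseʳ (forget x))))
    (λ x y → adj (forget x) (forget y))
    where
    module f = Inverse f

    forget : ∀ {R : Subset n} {r} → ∃ (_∈ R - r) → ∃ (_∈ R)
    forget (x , x∈) = x , x∈p-y⇒x∈p x∈

    to′ : ∃ (_∈ S - v) → ∃ (_∈ T - proj₁ (f.to (v , v∈S)))
    to′ x = proj₁ (f.to (forget x)) , x∈p∧x≢y⇒x∈p-y (proj₂ (f.to (forget x)))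
      (x∈p-y⇒x≢y (proj₂ x) ∘ to-injective (f , adj))

    from′ : ∃ (_∈ T - proj₁ (f.to (v , v∈S))) → ∃ (_∈ S - v)
    from′ y = proj₁ (f.from (forget y)) , x∈p∧x≢y⇒x∈p-y (proj₂ (f.from (forget y)))
      (λ eq → x∈p-y⇒x≢y (proj₂ y) (cong proj₁
        (trans (sym (f.strictlyInverseˡ _)) (cong f.to (∃∈-≡ eq)))))

  -- Membership in neighbourhoods.

  ∈-N⁺ : w ∈ S → Adj v w → w ∈ N G S v
  ∈-N⁺ {w} {v = v} w∈S vw = x∈p∩q⁺ (w∈S , lookup⇒[]= w _
    (trans (lookup∘tabulate _ w) (dec-true (adj? v w) vw)))

  ∈-N⁻ : w ∈ N G S v → w ∈ S × Adj v w
  ∈-N⁻ {w} {S} {v} w∈ with x∈p∩q⁻ S _ w∈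
  ... | w∈S , w∈row = w∈S , does-true⁻ (adj? v w)
          (trans (sym (lookup∘tabulate _ w)) ([]=⇒lookup w∈row))

  v∈N[v] : v ∈ N[_] G S v
  v∈N[v] {v} = x∈p∪q⁺ (inj₁ (x∈⁅x⁆ v))

  ∈-N[]⁺ : w ∈ S → Adj v w → w ∈ N[_] G S v
  ∈-N[]⁺ w∈S vw = x∈p∪q⁺ (inj₂ (∈-N⁺ w∈S vw))

  ∈-N[]⁻ : w ∈ N[_] G S v → w ≡ v ⊎ w ∈ S × Adj v w
  ∈-N[]⁻ {v = v} w∈ with x∈p∪q⁻ ⁅ v ⁆ _ w∈
  ... | inj₁ w∈⁅v⁆ = inj₁ (x∈⁅y⁆⇒x≡y v w∈⁅v⁆)
  ... | inj₂ w∈N   = inj₂ (∈-N⁻ w∈N)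

  ∈-N[]-≢ : w ≢ v → w ∈ N[_] G S v → Adj v w
  ∈-N[]-≢ w≢v w∈ with ∈-N[]⁻ w∈
  ... | inj₁ w≡v      = contradiction w≡v w≢v
  ... | inj₂ (_ , vw) = vw

  N[]⊆ : v ∈ S → N[_] G S v ⊆ S
  N[]⊆ v∈S w∈ with ∈-N[]⁻ w∈
  ... | inj₁ refl      = v∈S
  ... | inj₂ (w∈S , _) = w∈S

  -- One-vertex extensions as conditions on adjacency rows.

  data Pattern : Set where
    full empty twin : Pattern

  -- `full` merges universal with anti-pendant, `empty` isolated with pendant, and `twin` the two
  -- kinds of twins.
  Row : Pattern → Fin n → Fin n → Set
  Row full  u w = Unit
  Row empty u w = Empty
  Row twin  u w = Adj u w

  Agree : Subset n → Fin n → Fin n → Pattern → Set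
  Agree S v u p = ∀ {w} → w ∈ S → w ≢ v → w ≢ u → Adj v w ⇔ Row p u w

  Removable : Subset n → Fin n → Set
  Removable S v = ∃₂ λ u p → u ∈ S × u ≢ v × Agree S v u p

  -- Universal and isolated vertices come without a partner; the size bound supplies an arbitrary
  -- one.
  Extension⇒Removable : 1 < ∣ S ∣ → OneVertexExtension G S v → Removable S v
  Extension⇒Removable {S} {v} 1<S (universal eq) with 1<∣p∣⇒∃≢ 1<S v
  ... | u , u∈S , u≢v = u , full , u∈S , u≢v , λ w∈S w≢v w≢u →
    mk⇔ _ (λ _ → ∈-N[]-≢ w≢v (subst (_ ∈_) (sym eq) w∈S))
  Extension⇒Removable {S} {v} 1<S (isolated eq) with 1<∣p∣⇒∃≢ 1<S v
  ... | u , u∈S , u≢v = u , empty , u∈S , u≢v , λ w∈S w≢v w≢u →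
    mk⇔ (λ vw → ∉⊥ (subst (_ ∈_) eq (∈-N⁺ w∈S vw))) ⊥-elim
  Extension⇒Removable _ (antiPendant {u} u∈S u≢v eq) =
    u , full , u∈S , u≢v , λ w∈S w≢v w≢u →
      mk⇔ _ (λ _ → ∈-N[]-≢ w≢v (subst (_ ∈_) (sym eq) (x∈p∧x≢y⇒x∈p-y w∈S w≢u)))
  Extension⇒Removable _ (pendant {u} u∈S u≢v eq) =
    u , empty , u∈S , u≢v , λ w∈S w≢v w≢u →
      mk⇔ (λ vw → w≢u (x∈⁅y⁆⇒x≡y u (subst (_ ∈_) eq (∈-N⁺ w∈S vw)))) ⊥-elim
  Extension⇒Removable _ (trueTwin {u} u∈S u≢v eq) =
    u , twin , u∈S , u≢v , λ w∈S w≢v w≢u →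
      mk⇔ (λ vw → ∈-N[]-≢ w≢u (subst (_ ∈_) eq (∈-N[]⁺ w∈S vw)))
          (λ uw → ∈-N[]-≢ w≢v (subst (_ ∈_) (sym eq) (∈-N[]⁺ w∈S uw)))
  Extension⇒Removable _ (falseTwin {u} u∈S u≢v eq) =
    u , twin , u∈S , u≢v , λ w∈S w≢v w≢u →
      mk⇔ (λ vw → proj₂ (∈-N⁻ (subst (_ ∈_) eq (∈-N⁺ w∈S vw))))
          (λ uw → proj₂ (∈-N⁻ (subst (_ ∈_) (sym eq) (∈-N⁺ w∈S uw))))

  -- One-sided, so that the two halves of an agreement yield the two inclusions with `u` and `v`
  -- exchanged.
  twin-N[]⊆ : v ∈ S → Adj u v → (∀ {w} → w ∈ S → w ≢ v → w ≢ u → Adj v w → Adj u w) →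
              N[_] G S v ⊆ N[_] G S u
  twin-N[]⊆ {u = u} v∈S uv sub {w} w∈ with ∈-N[]⁻ w∈ | w ≟ u
  ... | _                | yes refl = v∈N[v]
  ... | inj₁ refl        | no _     = ∈-N[]⁺ v∈S uv
  ... | inj₂ (w∈S , vw)  | no w≢u   =
    ∈-N[]⁺ w∈S (sub w∈S (λ { refl → ¬Adj-refl vw }) w≢u vw)

  twin-N⊆ : ¬ Adj v u → (∀ {w} → w ∈ S → w ≢ v → w ≢ u → Adj v w → Adj u w) →
            N G S v ⊆ N G S u
  twin-N⊆ ¬vu sub w∈ with ∈-N⁻ w∈
  ... | w∈S , vw = ∈-N⁺ w∈S
    (sub w∈S (λ { refl → ¬Adj-refl vw }) (λ { refl → ¬vu vw }) vw)

  -- Adjacency of `v` and its partner selects between the two kinds of extension that share a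
  -- pattern.
  Removable⇒Extension : v ∈ S → Removable S v → OneVertexExtension G S v
  Removable⇒Extension {v} {S} v∈S (u , full , u∈S , u≢v , agree) with adj? v u
  ... | yes vu = universal (⊆-antisym (N[]⊆ v∈S) S⊆)
    where
    S⊆ : S ⊆ N[_] G S v
    S⊆ {w} w∈S with w ≟ v | w ≟ u
    ... | yes refl | _        = v∈N[v]
    ... | no _     | yes refl = ∈-N[]⁺ w∈S vu
    ... | no w≢v   | no w≢u   = ∈-N[]⁺ w∈S (from (agree w∈S w≢v w≢u) tt)
  ... | no ¬vu = antiPendant u∈S u≢v (⊆-antisym ⊆S-u S-u⊆)
    where
    ⊆S-u : N[_] G S v ⊆ S - u
    ⊆S-u w∈ = x∈p∧x≢y⇒x∈p-y (N[]⊆ v∈S w∈) (λ { refl → ¬vu (∈-N[]-≢ u≢v w∈) })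

    S-u⊆ : S - u ⊆ N[_] G S v
    S-u⊆ {w} w∈ with w ≟ v
    ... | yes refl = v∈N[v]
    ... | no w≢v   =
      ∈-N[]⁺ (x∈p-y⇒x∈p w∈) (from (agree (x∈p-y⇒x∈p w∈) w≢v (x∈p-y⇒x≢y w∈)) tt)
  Removable⇒Extension {v} {S} v∈S (u , empty , u∈S , u≢v , agree) with adj? v u
  ... | yes vu = pendant u∈S u≢v (⊆-antisym ⊆⁅u⁆ ⁅u⁆⊆)
    where
    ⊆⁅u⁆ : N G S v ⊆ ⁅ u ⁆
    ⊆⁅u⁆ {w} w∈ with ∈-N⁻ w∈ | w ≟ u
    ... | _        | yes refl = x∈⁅x⁆ u
    ... | w∈S , vw | no w≢u   =
      ⊥-elim (to (agree w∈S (λ { refl → ¬Adj-refl vw }) w≢u) vw)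

    ⁅u⁆⊆ : ⁅ u ⁆ ⊆ N G S v
    ⁅u⁆⊆ w∈ with refl ← x∈⁅y⁆⇒x≡y u w∈ = ∈-N⁺ u∈S vu
  ... | no ¬vu = isolated (Empty-unique λ (w , w∈) → let w∈S , vw = ∈-N⁻ w∈ in
    to (agree w∈S (λ { refl → ¬Adj-refl vw }) (λ { refl → ¬vu vw })) vw)
  Removable⇒Extension {v} {S} v∈S (u , twin , u∈S , u≢v , agree) with adj? v u
  ... | yes vu = trueTwin u∈S u≢v (⊆-antisym
    (twin-N[]⊆ v∈S (Adj-sym vu) (λ w∈S w≢v w≢u → to (agree w∈S w≢v w≢u)))
    (twin-N[]⊆ u∈S vu (λ w∈S w≢u w≢v → from (agree w∈S w≢v w≢u))))
  ... | no ¬vu = falseTwin u∈S u≢v (⊆-antisym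
    (twin-N⊆ ¬vu (λ w∈S w≢v w≢u → to (agree w∈S w≢v w≢u)))
    (twin-N⊆ (¬vu ∘ Adj-sym) (λ w∈S w≢u w≢v → from (agree w∈S w≢v w≢u))))

  -- The partner is a second vertex of `S`, so the size bound of `remove` is automatic.
  ⟶⁺ : v ∈ S → Removable S v → S ⇝ (S - v)
  ⟶⁺ v∈S r@(_ , _ , u∈S , u≢v , _) =
    remove (∃≢⇒1<∣p∣ v∈S u∈S u≢v) v∈S (Removable⇒Extension v∈S r)

  -- Decidability of removability.

  row? : ∀ p u w → Dec (Row p u w)
  row? full  u w = yes tt
  row? empty u w = no id
  row? twin  u w = adj? u w

  agree? : ∀ S v u p → Dec (Agree S v u p)
  agree? S v u p = map′
    (λ f w∈S w≢v w≢u → let g = f _ w∈S w≢v w≢u in mk⇔ (proj₁ g) (proj₂ g))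
    (λ f w w∈S w≢v w≢u → let g = f w∈S w≢v w≢u in to g , from g)
    (all? λ w → w ∈? S →-dec ¬? (w ≟ v) →-dec ¬? (w ≟ u) →-dec
      (adj? v w →-dec row? p u w) ×-dec (row? p u w →-dec adj? v w))

  anyPattern? : ∀ {P : Pattern → Set} → (∀ p → Dec (P p)) → Dec (∃ P)
  anyPattern? P? = map′
    (λ { (inj₁ p) → full , p ; (inj₂ (inj₁ p)) → empty , p ; (inj₂ (inj₂ p)) → twin , p })
    (λ { (full , p) → inj₁ p ; (empty , p) → inj₂ (inj₁ p) ; (twin , p) → inj₂ (inj₂ p) })
    (P? full ⊎-dec P? empty ⊎-dec P? twin)

  removable? : ∀ S v → Dec (Removable S v)
  removable? S v = any? λ u → anyPattern? λ p → u ∈? S ×-dec ¬? (u ≟ v) ×-dec agree? S v u p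

  -- Transport along isomorphisms, twins and local confluence.

  Row-≅ : ((f , _) : S ≃ T) (p : Pattern) (u w : ∃ (_∈ S)) →
          Row p (proj₁ u) (proj₁ w) ⇔ Row p (proj₁ (Inverse.to f u)) (proj₁ (Inverse.to f w))
  Row-≅ i full  u w = ⇔-id _
  Row-≅ i empty u w = ⇔-id _
  Row-≅ i twin  u w = proj₂ i u w

  Removable-≅ : (i : S ≃ T) (v∈S : v ∈ S) → Removable S v → Removable T (proj₁ (image i v∈S))
  Removable-≅ {S} {T} {v} i@(f , adj) v∈S (u , p , u∈S , u≢v , agree) =
    proj₁ (f.to (u , u∈S)) , p , proj₂ (f.to (u , u∈S)) , u≢v ∘ to-injective i , agree′
    where
    module f = Inverse f

    fv = proj₁ (f.to (v , v∈S))
    fu = proj₁ (f.to (u , u∈S))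

    -- Agreement is first checked at images under `f`, then carried to any `z` in `T` along
    -- `f (f⁻¹ z) ≡ z`.
    AgreeAt : Fin n → Set
    AgreeAt z = z ≢ fv → z ≢ fu → Adj fv z ⇔ Row p fu z

    agree-to : ∀ a → AgreeAt (proj₁ (f.to a))
    agree-to a a≢v a≢u = Row-≅ i p (u , u∈S) a ⇔-∘
      (agree (proj₂ a) (a≢v ∘ cong (proj₁ ∘ f.to) ∘ ∃∈-≡) (a≢u ∘ cong (proj₁ ∘ f.to) ∘ ∃∈-≡)
        ⇔-∘ ⇔-sym (adj (v , v∈S) a))

    agree′ : Agree T fv fu p
    agree′ w∈T = subst (AgreeAt ∘ proj₁) (f.strictlyInverseˡ (_ , w∈T)) (agree-to _)

  -- All vertices stay fixed except `w`, which moves to `v`. No pair in `S - v` involves both `v`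
  -- and `w`, so agreement outside the two suffices.
  ≅-twins : v ∈ S → w ∈ S → v ≢ w → Agree S v w twin → (S - v) ≃ (S - w)
  ≅-twins {v} {S} {w} v∈S w∈S v≢w agree = mk≅
    (λ (x , x∈) → replace w v x , replace-∈ (≢-sym v≢w) v∈S x∈)
    (λ (y , y∈) → replace v w y , replace-∈ v≢w w∈S y∈)
    (λ (y , y∈) → replace-inverse v w y (x∈p-y⇒x≢y y∈))
    (λ (x , x∈) → replace-inverse w v x (x∈p-y⇒x≢y x∈))
    adj
    where
    adj : (x y : ∃ (_∈ S - v)) →
          Adj (proj₁ x) (proj₁ y) ⇔ Adj (replace w v (proj₁ x)) (replace w v (proj₁ y))
    adj (x , x∈) (y , y∈) with x ≟ w | y ≟ w
    ... | yes refl | yes refl = mk⇔ (⊥-elim ∘ ¬Adj-refl) (⊥-elim ∘ ¬Adj-refl)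
    ... | yes refl | no y≢w   = ⇔-sym (agree (x∈p-y⇒x∈p y∈) (x∈p-y⇒x≢y y∈) y≢w)
    ... | no x≢w   | yes refl =
      Adj-comm ⇔-∘ (⇔-sym (agree (x∈p-y⇒x∈p x∈) (x∈p-y⇒x≢y x∈) x≢w) ⇔-∘ Adj-comm)
    ... | no _     | no _     = ⇔-id _

  -- A constant row stays constant when the partner of w is deleted, so any other
  -- remaining vertex can serve as the new partner.
  twins⊎Removable : v ∈ S → v ≢ w → Removable S w → Agree S w v twin ⊎ Removable (S - v) w
  twins⊎Removable {v} {S} {w} v∈S v≢w (u , p , u∈S , u≢w , agree) with u ≟ v
  ... | no u≢v = inj₂ (u , p , x∈p∧x≢y⇒x∈p-y u∈S u≢v , u≢w , λ z∈ → agree (x∈p-y⇒x∈p z∈))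
  twins⊎Removable {v} {S} {w} v∈S v≢w (u , p , u∈S , u≢w , agree) | yes refl
    with p | any? (λ z → z ∈? (S - v) ×-dec ¬? (z ≟ w))
  ... | twin  | _      = inj₁ agree
  ... | full  | yes (z , z∈ , z≢w) =
    inj₂ (z , full , z∈ , z≢w , λ y∈ y≢w _ → agree (x∈p-y⇒x∈p y∈) y≢w (x∈p-y⇒x≢y y∈))
  ... | empty | yes (z , z∈ , z≢w) =
    inj₂ (z , empty , z∈ , z≢w , λ y∈ y≢w _ → agree (x∈p-y⇒x∈p y∈) y≢w (x∈p-y⇒x≢y y∈))
  -- Here `S` has no vertices besides `v` and `w`, so the twin condition is vacuous.
  ... | _     | no ∄z = inj₁ λ y∈S y≢w y≢v →
    contradiction (_ , x∈p∧x≢y⇒x∈p-y y∈S y≢v , y≢w) ∄z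

  -- If either vertex loses removability once the other is deleted, the two are twins; otherwise
  -- both orders of deletion lead to `S - v - w`.
  diamond : v ∈ S → w ∈ S → Removable S v → Removable S w →
            (S - v) ≃ (S - w) ⊎ (∃ λ U → (S - v) ⇝ U × (S - w) ⇝ U)
  diamond {v} {S} {w} v∈S w∈S rv rw with v ≟ w
  ... | yes refl = inj₁ ≅-refl
  ... | no v≢w with twins⊎Removable v∈S v≢w rw | twins⊎Removable w∈S (≢-sym v≢w) rv
  ...   | inj₁ tw  | _        = inj₁ (≅-sym (≅-twins w∈S v∈S (≢-sym v≢w) tw))
  ...   | inj₂ _   | inj₁ tw  = inj₁ (≅-twins v∈S w∈S v≢w tw)
  ...   | inj₂ rw′ | inj₂ rv′ = inj₂
    ( S - v - w
    , ⟶⁺ (x∈p∧x≢y⇒x∈p-y w∈S (≢-sym v≢w)) rw′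
    , subst ((S - w) ⇝_) (p─x─y≡p─y─x S w v) (⟶⁺ (x∈p∧x≢y⇒x∈p-y v∈S v≢w) rv′))

  -- Existence and uniqueness of normal forms.

  Normal : Subset n → Set
  Normal S = ∀ {T} → ¬ S ⇝ T

  -- At `S = ⊤` this is `IsPrunedSubgraph`; the inductions need arbitrary starting sets.
  _⇝!_ : Subset n → Subset n → Set
  S ⇝! T = Star _⇝_ S T × Normal T

  ⟶-shrinks : S ⇝ T → ∣ T ∣ < ∣ S ∣
  ⟶-shrinks (remove _ v∈S _) = x∈p⇒∣p-x∣<∣p∣ v∈S

  -- Each deletion shrinks `S`, so recursion on the size bound `k` terminates.
  normalise : ∀ k S → ∣ S ∣ ≤ k → ∃ (S ⇝!_)
  normalise k S S≤k with any? (λ v → v ∈? S ×-dec removable? S v)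
  ... | no ∄v = S , ε , λ { (remove 1<S v∈S e) → ∄v (_ , v∈S , Extension⇒Removable 1<S e) }
  normalise zero S S≤k | yes (v , v∈S , r) =
    contradiction (<-≤-trans (⟶-shrinks (⟶⁺ v∈S r)) S≤k) n≮0
  normalise (suc k) S S≤k | yes (v , v∈S , r) =
    let step = ⟶⁺ v∈S r
        T , steps , nf = normalise k (S - v) (≤-pred (<-≤-trans (⟶-shrinks step) S≤k))
    in T , step ◅ steps , nf

  -- Excludes that one of two isomorphic graphs is normal while the other admits a step.
  ⟶-≅ : S ≃ T → S ⇝ U → ∃ (T ⇝_)
  ⟶-≅ i (remove 1<S v∈S e) =
    _ , ⟶⁺ (proj₂ (image i v∈S)) (Removable-≅ i v∈S (Extension⇒Removable 1<S e))

  -- Newman's induction, on a common size bound. The starting sets are only isomorphic because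
  -- `diamond` may close only up to isomorphism.
  ⇝!-unique : ∀ k {S T A B} → ∣ S ∣ ≤ k → ∣ T ∣ ≤ k → S ≃ T → S ⇝! A → T ⇝! B → A ≃ B
  ⇝!-unique k _ _ i (ε , _) (ε , _) = i
  ⇝!-unique k _ _ i (ε , nf) (step ◅ _ , _) =
    contradiction (proj₂ (⟶-≅ (≅-sym i) step)) nf
  ⇝!-unique k _ _ i (step ◅ _ , _) (ε , nf) =
    contradiction (proj₂ (⟶-≅ i step)) nf
  ⇝!-unique zero S≤k _ i (step ◅ _ , _) (_ ◅ _ , _) =
    contradiction (<-≤-trans (⟶-shrinks step) S≤k) n≮0
  ⇝!-unique (suc k) {T = T} S≤k T≤k i
    (step₁@(remove 1<S v∈S e₁) ◅ steps₁ , nfA) (step₂@(remove 1<T w∈T e₂) ◅ steps₂ , nfB) =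
    join (diamond fv∈T w∈T r (Extension⇒Removable 1<T e₂))
    where
    fv∈T = proj₂ (image i v∈S)

    -- The first deletion in `S` is copied to `T`, where it can be compared with the first deletion
    -- there.
    r : Removable T (proj₁ (image i v∈S))
    r = Removable-≅ i v∈S (Extension⇒Removable 1<S e₁)

    S′≤k = ≤-pred (<-≤-trans (⟶-shrinks step₁) S≤k)
    T′≤k = ≤-pred (<-≤-trans (⟶-shrinks (⟶⁺ fv∈T r)) T≤k)
    T″≤k = ≤-pred (<-≤-trans (⟶-shrinks step₂) T≤k)

    join : _ ⊎ _ → _
    join (inj₁ j) = ⇝!-unique k S′≤k T″≤k (≅-trans (≅-remove i v∈S) j) (steps₁ , nfA) (steps₂ , nfB)
    -- A normal form `C` of the common reduct links the two sides: `A ≃ C` via the copied deletion,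
    -- `C ≃ B` via the deletion of `w`.
    join (inj₂ (U , T′⇝U , T″⇝U)) with normalise _ U ≤-refl
    ... | C , U⇝C , nfC = ≅-trans
      (⇝!-unique k S′≤k T′≤k (≅-remove i v∈S) (steps₁ , nfA) (T′⇝U ◅ U⇝C , nfC))
      (⇝!-unique k T″≤k T″≤k ≅-refl (T″⇝U ◅ U⇝C , nfC) (steps₂ , nfB))

corollary2 : ∀ {n : ℕ} (G : Graph n) → ∃! (_≅_ G) (IsPrunedSubgraph G)
corollary2 G = let A , p = normalise G _ ⊤ ≤-refl in
  A , p , ⇝!-unique G _ ≤-refl ≤-refl (≅-refl G) p
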